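{- If $\Delta_i \sim_{cs} \Theta_i$ for $i = 1, 2$, then $p\cdot\Delta_1 + (1-p)\cdot\Delta_2 \sim_{cs} p\cdot\Theta_1 + (1-p)\cdot\Theta_2$ for any $p \in [0, 1]$.
   Context: lqCCS is a quantum process calculus with a linear type system (each qubit sent or discarded exactly once). An observer $R$ is an lqCCS process without $\tau$ prefixes and restrictions, whose sums consist only of inputs, and in which no sum contains two inputs on the same channel. Extended configurations are triples $\langle\!\langle \rho, P, R \rangle\!\rangle$ of a density operator $\rho$, a process $P$ and an observer $R$, plus a deadlock configuration $\bot$; $\Delta,\Theta$ range over finitely supported probability distributions over them. Contexts $O[\cdot] = [\cdot] \parallel R'$ put an observer $R'$ in parallel with the observer component. The enhanced semantics has transitions $\mathcal{C} \rightsquigarrow_\pi \Delta$ with index $\pi = \diamond$ when only the process moves (standard probabilistic reduction: $\tau$, superoperators, measurements, internal communication), and $\pi \in \{\ell,r\}^*$ recording which parallel component of the observer acts (observer applies a superoperator or measurement, receives a value output by the process, or sends a value to it); a configuration with no $\pi$-move goes to $\overline{\bot}$, and transitions are lifted to distributions by linearity, so a distribution makes a $\pi$-move only if every configuration in its support moves with the same index. A distribution satisfies the barb $\downarrow_c^p$ if the total probability of configurations whose process or observer is ready to output on the free channel $c$ is $p$, and $\downarrow_\bot^p$ if it assigns probability $p$ to $\bot$. Constrained saturated bisimilarity $\sim_{cs}$ is the largest relation $\mathcal{R}$ on equally typed distributions such that $\Delta \mathcal{R} \Theta$ implies, for every context $O[\cdot]$: $\Delta$ and $\Theta$ satisfy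 the same barbs; whenever $O[\Delta] \rightsquigarrow_\pi \Delta'$ there is $\Theta'$ with $O[\Theta] \rightsquigarrow_\pi \Theta'$ and $\Delta' \mathcal{R} \Theta'$; and symmetrically. -}

module Defs where

open import Level using (0ℓ)
open import Algebra.Core using (Op₁; Op₂)
open import Algebra.Structures using (IsCommutativeRing)
open import Axiom.ExcludedMiddle using (ExcludedMiddle)
open import Data.Bool as Bool using (Bool; true; false; if_then_else_)
open import Data.Fin using (Fin; zero; suc; toℕ; _↑ˡ_; _↑ʳ_; finToFun; funToFin; combine; remQuot)
import Data.Fin.Properties as Fin
open import Data.Fin.Subset as Subset using (Subset; Side; inside; outside; _∪_; _∩_; ⁅_⁆; ⋃)
open import Data.List as List using (List; []; _∷_; _++_)
open import Data.List.Relation.Binary.Disjoint.Propositional using (Disjoint)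
open import Data.List.Relation.Unary.All as All using (All; []; _∷_)
import Data.List.Relation.Unary.All.Properties as AllP
import Data.List.Relation.Unary.Unique.Propositional as ListUnique
open import Data.Nat as ℕ using (ℕ; zero; suc; _^_)
open import Data.Empty using () renaming (⊥ to Empty)
open import Data.Product using (∃; Σ-syntax; _×_; _,_; proj₁; proj₂; map₂)
open import Data.Sum using (_⊎_; inj₁; inj₂)
open import Data.Unit using (⊤)
open import Data.Vec as Vec using (Vec; []; _∷_; lookup; tabulate)
import Data.Vec.Functional as Fun
import Data.Vec.Relation.Unary.All as VecAll
import Data.Vec.Relation.Unary.Unique.Propositional as VecUnique
open import Function using (_∘_; _⇔_)
open import Relation.Binary.Core using (Rel)
open import Relation.Binary.PropositionalEquality
  using (_≡_; _≢_; refl; sym; trans; cong; cong₂; subst; subst₂; module ≡-Reasoning)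
open import Relation.Binary.Structures using (IsTotalOrder)
open import Relation.Nullary using (¬_; Dec; yes; no; does)

-- A Dedekind-complete ordered field.  Classically these axioms determine ℝ up
-- to isomorphism.  The value of 0# ⁻¹ is unspecified.
record Reals : Set₁ where
  infix  8 _⁻¹
  infix  8 -_
  infixl 7 _*_
  infixl 6 _+_ _-_
  infix  4 _≤_
  field
    Carrier           : Set
    _+_ _*_           : Op₂ Carrier
    -_ _⁻¹            : Op₁ Carrier
    0# 1#             : Carrier
    _≤_               : Rel Carrier 0ℓ
    isCommutativeRing : IsCommutativeRing _≡_ _+_ _*_ -_ 0# 1#
    isTotalOrder      : IsTotalOrder _≡_ _≤_
    0≢1               : 0# ≢ 1#
    ⁻¹-inverseʳ       : ∀ {x} → x ≢ 0# → x * x ⁻¹ ≡ 1#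
    +-monoˡ-≤         : ∀ z {x y} → x ≤ y → x + z ≤ y + z
    *-nonneg          : ∀ {x y} → 0# ≤ x → 0# ≤ y → 0# ≤ x * y

  _-_ : Op₂ Carrier
  x - y = x + (- y)

  UpperBound : (Carrier → Set) → Carrier → Set
  UpperBound A u = ∀ x → A x → x ≤ u

  field
    supremum : (A : Carrier → Set) → ∃ A → ∃ (UpperBound A) →
               Σ[ s ∈ Carrier ] UpperBound A s × (∀ u → UpperBound A u → s ≤ u)

  open IsCommutativeRing isCommutativeRing public
    using (+-assoc; +-comm; +-identityˡ; +-identityʳ; -‿inverseˡ; -‿inverseʳ;
           *-identityʳ; distribˡ; zeroʳ)
  open IsTotalOrder isTotalOrder public
    using () renaming (total to ≤-total)

-- Basis states of n qubits are the elements of Fin (2 ^ n), read as functions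
-- Fin n → Fin 2 along finToFun / funToFin.
module _ {m n : ℕ} (q̃ : Vec (Fin n) m) where

  select : Fin (2 ^ n) → Fin (2 ^ m)
  select i = funToFin {m} {2} (λ j → finToFun {2} {n} i (lookup q̃ j))

  overwrite : Fin (2 ^ n) → Fin (2 ^ m) → Fin (2 ^ n)
  overwrite i x = funToFin {n} {2} bit
    where
    bit : Fin n → Fin 2
    bit p with Fin.any? (λ j → lookup q̃ j Fin.≟ p)
    ... | yes (j , _) = finToFun {2} {m} x j
    ... | no  _       = finToFun {2} {n} i p

data Ty : Set where
  bool nat qubit : Ty

-- Every channel carries values of one fixed type, and there are infinitely many
-- channels of each type.
record Chan : Set where
  constructor chan
  field
    ident : ℕ
    ty    : Ty
open Chan public

data Dir : Set where
  ℓ r : Dir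

data Index : Set where
  ⋄    : Index
  path : List Dir → Index

-- Excluded middle serves to compute probabilities of events; in particular,
-- equality of configurations, which contain real matrices, is not decidable.
module LqCCS (em : ExcludedMiddle 0ℓ) (ℝ : Reals) where

  open Reals ℝ renaming (Carrier to Real)

  private variable
    A B       : Set
    d k l m n : ℕ

  record ℂ : Set where
    constructor _+i_
    field
      re im : Real
  open ℂ public

  0ℂ 1ℂ : ℂ
  0ℂ = 0# +i 0#
  1ℂ = 1# +i 0#

  _+ℂ_ _*ℂ_ : Op₂ ℂ
  (a +i b) +ℂ (a' +i b') = (a + a') +i (b + b')
  (a +i b) *ℂ (a' +i b') = (a * a' - b * b') +i (a * b' + b * a')

  conj : Op₁ ℂ
  conj (a +i b) = a +i (- b)

  ∑ : (Fin d → ℂ) → ℂ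
  ∑ = Fun.foldr _+ℂ_ 0ℂ

  Mat : ℕ → Set
  Mat d = Vec (Vec ℂ d) d

  entry : Mat d → Fin d → Fin d → ℂ
  entry M i j = lookup (lookup M i) j

  mat : (Fin d → Fin d → ℂ) → Mat d
  mat f = tabulate (λ i → tabulate (f i))

  𝟙ₘ : Mat d
  𝟙ₘ = mat (λ i j → if does (i Fin.≟ j) then 1ℂ else 0ℂ)

  𝟘ₘ : Mat d
  𝟘ₘ = mat (λ _ _ → 0ℂ)

  _+ₘ_ _*ₘ_ : Op₂ (Mat d)
  M +ₘ N = mat (λ i j → entry M i j +ℂ entry N i j)
  M *ₘ N = mat (λ i j → ∑ (λ x → entry M i x *ℂ entry N x j))

  _† : Op₁ (Mat d)
  M † = mat (λ i j → conj (entry M j i))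

  scale : Real → Mat d → Mat d
  scale a M = mat (λ i j → (a +i 0#) *ℂ entry M i j)

  trace : Mat d → ℂ
  trace M = ∑ (λ i → entry M i i)

  Positive : Mat d → Set
  Positive {d} M = (v : Fin d → ℂ) →
    let z = ∑ (λ i → ∑ (λ j → conj (v i) *ℂ (entry M i j *ℂ v j)))
    in  0# ≤ re z × im z ≡ 0#

  IsDensity : Mat d → Set
  IsDensity ρ = Positive ρ × trace ρ ≡ 1ℂ

  -- A linear map on d × d matrices, given by its coefficients:
  -- E(X)ᵢⱼ = Σₓᵧ E[i,j]ₓᵧ Xₓᵧ.
  LinMap : ℕ → Set
  LinMap d = Vec (Vec (Mat d) d) d

  apply : LinMap d → Mat d → Mat d
  apply E X = mat (λ i j → ∑ (λ x → ∑ (λ y →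
    entry (lookup (lookup E i) j) x y *ℂ entry X x y)))

  -- E ⊗ id on ℂᵈ ⊗ ℂᵏ.
  _⊗id_ : (Mat d → Mat d) → ∀ k → Mat (d ℕ.* k) → Mat (d ℕ.* k)
  _⊗id_ {d} E k X = mat λ i j →
    let (a , s) = remQuot {d} k i
        (b , t) = remQuot {d} k j
    in  entry (E (mat (λ x y → entry X (combine x s) (combine y t)))) a b

  CompletelyPositive : (Mat d → Mat d) → Set
  CompletelyPositive {d} E =
    ∀ k (X : Mat (d ℕ.* k)) → Positive X → Positive ((E ⊗id k) X)

  TracePreserving : (Mat d → Mat d) → Set
  TracePreserving {d} E = ∀ (X : Mat d) → trace (E X) ≡ trace X

  -- The laws are irrelevant fields, so that operators with equal matrices are
  -- equal (and likewise the processes mentioning them).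
  record SuperOp (m : ℕ) : Set where
    field
      linMap : LinMap (2 ^ m)
      .cp    : CompletelyPositive (apply linMap)
      .tp    : TracePreserving (apply linMap)

  -- Measurements of m qubits with outcomes 0, …, l - 1.
  record Measurement (m l : ℕ) : Set where
    field
      kraus     : Vec (Mat (2 ^ m)) l
      .complete : Vec.foldr′ _+ₘ_ 𝟘ₘ (Vec.map (λ M → (M †) *ₘ M) kraus) ≡ 𝟙ₘ

  -- The action of E on the qubits q̃ of an n-qubit system (q̃ distinct), and the
  -- identity on the other qubits.
  onQubits : (Mat (2 ^ m) → Mat (2 ^ m)) → Vec (Fin n) m → Mat (2 ^ n) → Mat (2 ^ n)
  onQubits E q̃ ρ = mat λ i j →
    entry (E (mat (λ x y → entry ρ (overwrite q̃ i x) (overwrite q̃ j y))))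
          (select q̃ i) (select q̃ j)

  weight : List (Real × A) → Real
  weight []             = 0#
  weight ((w , _) ∷ xs) = w + weight xs

  -- A formal convex combination Σᵢ wᵢ • aᵢ; the aᵢ may repeat and the wᵢ may be
  -- 0#, so the distribution denoted is given by mass below.
  record Dist (A : Set) : Set where
    constructor dist
    field
      entries : List (Real × A)
      nonneg  : All (λ e → 0# ≤ proj₁ e) entries
      total   : weight entries ≡ 1#
  open Dist public

  indicator : Set → Real
  indicator P = if does (em {P}) then 1# else 0#

  expect : (A → Real) → List (Real × A) → Real
  expect f []             = 0#
  expect f ((w , a) ∷ xs) = w * f a + expect f xs

  Pr : Dist A → (A → Set) → Real
  Pr Δ P = expect (λ a → indicator (P a)) (entries Δ)

  mass : Dist A → A → Real
  mass Δ a = Pr Δ (_≡ a)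

  _∈supp_ : A → Dist A → Set
  a ∈supp Δ = mass Δ a ≢ 0#

  0≤1 : 0# ≤ 1#
  0≤1 with ≤-total 0# 1#
  ... | inj₁ 0≤1 = 0≤1
  ... | inj₂ 1≤0 = subst (0# ≤_) -1*-1≡1 (*-nonneg 0≤-1 0≤-1)
    where
    open ≡-Reasoning
    0≤-1 : 0# ≤ - 1#
    0≤-1 = subst₂ _≤_ (-‿inverseʳ 1#) (+-identityˡ (- 1#)) (+-monoˡ-≤ (- 1#) 1≤0)
    -1*-1+-1≡0 : (- 1#) * (- 1#) + (- 1#) ≡ 0#
    -1*-1+-1≡0 = begin
      (- 1#) * (- 1#) + (- 1#)      ≡⟨ cong ((- 1#) * (- 1#) +_) (sym (*-identityʳ (- 1#))) ⟩
      (- 1#) * (- 1#) + (- 1#) * 1# ≡⟨ sym (distribˡ (- 1#) (- 1#) 1#) ⟩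
      (- 1#) * (- 1# + 1#)          ≡⟨ cong ((- 1#) *_) (-‿inverseˡ 1#) ⟩
      (- 1#) * 0#                   ≡⟨ zeroʳ (- 1#) ⟩
      0#                            ∎
    -1*-1≡1 : (- 1#) * (- 1#) ≡ 1#
    -1*-1≡1 = begin
      (- 1#) * (- 1#)                 ≡⟨ sym (+-identityʳ _) ⟩
      (- 1#) * (- 1#) + 0#            ≡⟨ cong ((- 1#) * (- 1#) +_) (sym (-‿inverseˡ 1#)) ⟩
      (- 1#) * (- 1#) + (- 1# + 1#)   ≡⟨ sym (+-assoc _ _ _) ⟩
      (- 1#) * (- 1#) + (- 1#) + 1#   ≡⟨ cong (_+ 1#) -1*-1+-1≡0 ⟩
      0# + 1#                         ≡⟨ +-identityˡ 1# ⟩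
      1#                              ∎

  0≤1-p : ∀ {p} → p ≤ 1# → 0# ≤ 1# - p
  0≤1-p {p} p≤1 = subst (_≤ 1# - p) (-‿inverseʳ p) (+-monoˡ-≤ (- p) p≤1)

  p+[1-p]≡1 : ∀ p → p + (1# - p) ≡ 1#
  p+[1-p]≡1 p = begin
    p + (1# - p)      ≡⟨ cong (p +_) (+-comm 1# (- p)) ⟩
    p + (- p + 1#)    ≡⟨ sym (+-assoc p (- p) 1#) ⟩
    p + (- p) + 1#    ≡⟨ cong (_+ 1#) (-‿inverseʳ p) ⟩
    0# + 1#           ≡⟨ +-identityˡ 1# ⟩
    1#                ∎
    where open ≡-Reasoning

  scaleEntries : Real → List (Real × A) → List (Real × A)
  scaleEntries p = List.map (λ (w , a) → p * w , a)

  weight-map₂ : (f : A → B) (xs : List (Real × A)) → weight (List.map (map₂ f) xs) ≡ weight xs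
  weight-map₂ f []             = refl
  weight-map₂ f ((w , _) ∷ xs) = cong (w +_) (weight-map₂ f xs)

  weight-++ : (xs ys : List (Real × A)) → weight (xs ++ ys) ≡ weight xs + weight ys
  weight-++ []             ys = sym (+-identityˡ _)
  weight-++ ((w , _) ∷ xs) ys = trans (cong (w +_) (weight-++ xs ys)) (sym (+-assoc w _ _))

  weight-scale : ∀ p (xs : List (Real × A)) → weight (scaleEntries p xs) ≡ p * weight xs
  weight-scale p []             = sym (zeroʳ p)
  weight-scale p ((w , _) ∷ xs) = trans (cong (p * w +_) (weight-scale p xs)) (sym (distribˡ p w _))

  nonneg-scale : ∀ {p} → 0# ≤ p → {xs : List (Real × A)} →
                 All (λ e → 0# ≤ proj₁ e) xs → All (λ e → 0# ≤ proj₁ e) (scaleEntries p xs)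
  nonneg-scale 0≤p = AllP.map⁺ ∘ All.map (*-nonneg 0≤p)

  dirac : A → Dist A
  dirac a = dist ((1# , a) ∷ []) (0≤1 ∷ []) (+-identityʳ 1#)

  mapᴰ : (A → B) → Dist A → Dist B
  mapᴰ f (dist xs nn tot) =
    dist (List.map (map₂ f) xs) (AllP.map⁺ nn) (trans (weight-map₂ f xs) tot)

  -- p · Δ + (1 - p) · Θ
  mix : (p : Real) → 0# ≤ p → p ≤ 1# → Dist A → Dist A → Dist A
  mix p 0≤p p≤1 (dist xs nn tot) (dist ys nn' tot') = dist
    (scaleEntries p xs ++ scaleEntries (1# - p) ys)
    (AllP.++⁺ (nonneg-scale 0≤p nn) (nonneg-scale (0≤1-p p≤1) nn'))
    (begin
      weight (scaleEntries p xs ++ scaleEntries (1# - p) ys)          ≡⟨ weight-++ (scaleEntries p xs) _ ⟩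
      weight (scaleEntries p xs) + weight (scaleEntries (1# - p) ys)  ≡⟨ cong₂ _+_ (weight-scale p xs) (weight-scale (1# - p) ys) ⟩
      p * weight xs + (1# - p) * weight ys                            ≡⟨ cong₂ _+_ (cong (p *_) tot) (cong ((1# - p) *_) tot') ⟩
      p * 1# + (1# - p) * 1#                                          ≡⟨ cong₂ _+_ (*-identityʳ p) (*-identityʳ (1# - p)) ⟩
      p + (1# - p)                                                    ≡⟨ p+[1-p]≡1 p ⟩
      1#                                                              ∎)
    where open ≡-Reasoning

  -- In Proc n Γ the qubits are the elements of Fin n, i.e. all qubits of the
  -- state, and variables are de Bruijn indices into Γ.

  Val : ℕ → Ty → Set
  Val n bool  = Bool
  Val n nat   = ℕ
  Val n qubit = Fin n

  data Exp (n : ℕ) (Γ : Vec Ty k) : Ty → Set where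
    var   : ∀ {T} (x : Fin k) → lookup Γ x ≡ T → Exp n Γ T
    lit   : ∀ {T} → Val n T → Exp n Γ T
    ¬ᵉ_   : Exp n Γ bool → Exp n Γ bool
    _∨ᵉ_  : Exp n Γ bool → Exp n Γ bool → Exp n Γ bool
    _≤ᵉ_  : Exp n Γ nat → Exp n Γ nat → Exp n Γ bool

  infix  9 _⟦_⟧ _[_]
  infixl 7 _∖_
  infixr 6 _∥_
  infixr 6 _⊕_
  infix  4 _∋_ _∈supp_

  mutual
    data Proc (n : ℕ) (Γ : Vec Ty k) : Set where
      sum : Sum n Γ → Proc n Γ
      _∥_ : Proc n Γ → Proc n Γ → Proc n Γ
      _∖_ : Proc n Γ → Chan → Proc n Γ
      ite : Exp n Γ bool → Proc n Γ → Proc n Γ → Proc n Γ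

    data Sum (n : ℕ) (Γ : Vec Ty k) : Set where
      discard : List (Exp n Γ qubit) → Sum n Γ
      tau     : Proc n Γ → Sum n Γ
      op      : SuperOp m → Vec (Exp n Γ qubit) m → Proc n Γ → Sum n Γ
      meas    : Measurement m l → Vec (Exp n Γ qubit) m → Proc n (nat ∷ Γ) → Sum n Γ
      recv    : (c : Chan) → Proc n (ty c ∷ Γ) → Sum n Γ
      send    : (c : Chan) → Exp n Γ (ty c) → Sum n Γ
      _⊕_     : Sum n Γ → Sum n Γ → Sum n Γ

  eval : ∀ {T} → Exp n [] T → Val n T
  eval (lit v)  = v
  eval (¬ᵉ e)   = Bool.not (eval e)
  eval (e ∨ᵉ f) = eval e Bool.∨ eval f
  eval (e ≤ᵉ f) = eval e ℕ.≤ᵇ eval f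

  Sub : ℕ → Vec Ty k → Vec Ty l → Set
  Sub {k} n Γ Γ' = (x : Fin k) → Exp n Γ' (lookup Γ x)

  weaken : ∀ {Γ : Vec Ty k} {T U} → Exp n Γ T → Exp n (U ∷ Γ) T
  weaken (var x eq) = var (suc x) eq
  weaken (lit v)    = lit v
  weaken (¬ᵉ e)     = ¬ᵉ weaken e
  weaken (e ∨ᵉ f)   = weaken e ∨ᵉ weaken f
  weaken (e ≤ᵉ f)   = weaken e ≤ᵉ weaken f

  lift : ∀ {Γ : Vec Ty k} {Γ' : Vec Ty l} {U} → Sub n Γ Γ' → Sub n (U ∷ Γ) (U ∷ Γ')
  lift σ zero    = var zero refl
  lift σ (suc x) = weaken (σ x)

  subᵉ : ∀ {Γ : Vec Ty k} {Γ' : Vec Ty l} {T} → Sub n Γ Γ' → Exp n Γ T → Exp n Γ' T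
  subᵉ σ (var x refl) = σ x
  subᵉ σ (lit v)      = lit v
  subᵉ σ (¬ᵉ e)       = ¬ᵉ subᵉ σ e
  subᵉ σ (e ∨ᵉ f)     = subᵉ σ e ∨ᵉ subᵉ σ f
  subᵉ σ (e ≤ᵉ f)     = subᵉ σ e ≤ᵉ subᵉ σ f

  mutual
    sub : ∀ {Γ : Vec Ty k} {Γ' : Vec Ty l} → Sub n Γ Γ' → Proc n Γ → Proc n Γ'
    sub σ (sum S)     = sum (subˢ σ S)
    sub σ (P ∥ Q)     = sub σ P ∥ sub σ Q
    sub σ (P ∖ c)     = sub σ P ∖ c
    sub σ (ite e P Q) = ite (subᵉ σ e) (sub σ P) (sub σ Q)

    subˢ : ∀ {Γ : Vec Ty k} {Γ' : Vec Ty l} → Sub n Γ Γ' → Sum n Γ → Sum n Γ'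
    subˢ σ (discard es)  = discard (List.map (subᵉ σ) es)
    subˢ σ (tau P)       = tau (sub σ P)
    subˢ σ (op E es P)   = op E (Vec.map (subᵉ σ) es) (sub σ P)
    subˢ σ (meas M es P) = meas M (Vec.map (subᵉ σ) es) (sub (lift σ) P)
    subˢ σ (recv c P)    = recv c (sub (lift σ) P)
    subˢ σ (send c e)    = send c (subᵉ σ e)
    subˢ σ (S ⊕ T)       = subˢ σ S ⊕ subˢ σ T

  _[_] : ∀ {T} → Proc n (T ∷ []) → Val n T → Proc n []
  P [ v ] = sub (λ { zero → lit v }) P

  -- Resource sets are subsets of Fin (k + n): the first k elements stand for the
  -- variables in scope (only those of type qubit ever occur), the last n for the
  -- qubits.
  name : ∀ {Γ : Vec Ty k} → Exp n Γ qubit → Fin (k ℕ.+ n)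
  name {n = n} (var x _) = x ↑ˡ n
  name {k = k} (lit q)   = k ↑ʳ q

  owned : ∀ {Γ : Vec Ty k} T → Exp n Γ T → Subset (k ℕ.+ n)
  owned qubit e = ⁅ name e ⁆
  owned bool  _ = Subset.⊥
  owned nat   _ = Subset.⊥

  linear : Ty → Side
  linear qubit = inside
  linear bool  = outside
  linear nat   = outside

  infix 4 _⊢_ _⊢ˢ_ _⊢ᶜ_ _⊢ᴰ_ _⊢_∼cs_

  mutual
    data _⊢_ {n} {Γ : Vec Ty k} : Subset (k ℕ.+ n) → Proc n Γ → Set where
      sum : ∀ {Σ S} → Σ ⊢ˢ S → Σ ⊢ sum S
      par : ∀ {Σ₁ Σ₂ P Q} → Σ₁ ⊢ P → Σ₂ ⊢ Q → Σ₁ ∩ Σ₂ ≡ Subset.⊥ → Σ₁ ∪ Σ₂ ⊢ P ∥ Q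
      res : ∀ {Σ P c} → Σ ⊢ P → Σ ⊢ P ∖ c
      ite : ∀ {Σ e P Q} → Σ ⊢ P → Σ ⊢ Q → Σ ⊢ ite e P Q

    data _⊢ˢ_ {n} {Γ : Vec Ty k} : Subset (k ℕ.+ n) → Sum n Γ → Set where
      discard : ∀ {es} → ListUnique.Unique (List.map name es) →
                ⋃ (List.map (⁅_⁆ ∘ name) es) ⊢ˢ discard es
      tau     : ∀ {Σ P} → Σ ⊢ P → Σ ⊢ˢ tau P
      op      : ∀ {Σ P} {E : SuperOp m} {es} →
                VecUnique.Unique (Vec.map name es) → VecAll.All (λ e → name e Subset.∈ Σ) es →
                Σ ⊢ P → Σ ⊢ˢ op E es P
      meas    : ∀ {Σ P} {M : Measurement m l} {es} →
                VecUnique.Unique (Vec.map name es) → VecAll.All (λ e → name e Subset.∈ Σ) es →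
                (outside ∷ Σ) ⊢ P → Σ ⊢ˢ meas M es P
      recv    : ∀ {Σ c P} → (linear (ty c) ∷ Σ) ⊢ P → Σ ⊢ˢ recv c P
      send    : ∀ {c e} → owned (ty c) e ⊢ˢ send c e
      _⊕_     : ∀ {Σ S T} → Σ ⊢ˢ S → Σ ⊢ˢ T → Σ ⊢ˢ S ⊕ T

  -- S ∋ U for a non-sum U: U is one of the summands of S.
  data _∋_ {n} {Γ : Vec Ty k} : Sum n Γ → Sum n Γ → Set where
    here  : ∀ {S} → S ∋ S
    left  : ∀ {S T U} → S ∋ U → (S ⊕ T) ∋ U
    right : ∀ {S T U} → T ∋ U → (S ⊕ T) ∋ U

  -- Out and In are the visible actions of a process.  They let reduction be given
  -- without structural congruence: scope extrusion and the commutativity and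
  -- associativity of ∥ and ⊕ are absorbed by the rules.
  data Out {n} (c : Chan) (v : Val n (ty c)) : Proc n [] → Proc n [] → Set where
    send : ∀ {S e} → S ∋ send c e → eval e ≡ v → Out c v (sum S) (sum (discard []))
    parˡ : ∀ {P P' Q} → Out c v P P' → Out c v (P ∥ Q) (P' ∥ Q)
    parʳ : ∀ {P Q Q'} → Out c v Q Q' → Out c v (P ∥ Q) (P ∥ Q')
    res  : ∀ {P P' c'} → c ≢ c' → Out c v P P' → Out c v (P ∖ c') (P' ∖ c')
    iteᵗ : ∀ {e P P' Q} → eval e ≡ true  → Out c v P P' → Out c v (ite e P Q) P'
    iteᶠ : ∀ {e P Q Q'} → eval e ≡ false → Out c v Q Q' → Out c v (ite e P Q) Q'

  data In {n} (c : Chan) (v : Val n (ty c)) : Proc n [] → Proc n [] → Set where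
    recv : ∀ {S P} → S ∋ recv c P → In c v (sum S) (P [ v ])
    parˡ : ∀ {P P' Q} → In c v P P' → In c v (P ∥ Q) (P' ∥ Q)
    parʳ : ∀ {P Q Q'} → In c v Q Q' → In c v (P ∥ Q) (P ∥ Q')
    res  : ∀ {P P' c'} → c ≢ c' → In c v P P' → In c v (P ∖ c') (P' ∖ c')
    iteᵗ : ∀ {e P P' Q} → eval e ≡ true  → In c v P P' → In c v (ite e P Q) P'
    iteᶠ : ∀ {e P Q Q'} → eval e ≡ false → In c v Q Q' → In c v (ite e P Q) Q'

  State : ℕ → Set
  State n = Mat (2 ^ n)

  applyOp : SuperOp m → Vec (Exp n [] qubit) m → State n → State n
  applyOp E es = onQubits (apply (SuperOp.linMap E)) (Vec.map eval es)

  -- Outcome o has probability tr(Mₒ ρ Mₒ†), leaves the state Mₒ ρ Mₒ† normalised,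
  -- and binds the variable of the continuation to o.  Outcomes of probability 0
  -- keep an arbitrary state, but with weight 0 they are not in the support.
  outcomes : Measurement m l → Vec (Exp n [] qubit) m → State n → Proc n (nat ∷ []) →
             List (Real × (State n × Proc n []))
  outcomes {l = l} M es ρ P = List.tabulate {n = l} λ o →
    let Mₒ = lookup (Measurement.kraus M) o
        ρₒ = onQubits (λ X → Mₒ *ₘ (X *ₘ (Mₒ †))) (Vec.map eval es) ρ
        pₒ = re (trace ρₒ)
    in  pₒ , (scale (pₒ ⁻¹) ρₒ , P [ toℕ o ])

  infix 4 _⟶_ _⇝[_]_ _⇝ᴰ[_]_

  data _⟶_ {n} : State n × Proc n [] → Dist (State n × Proc n []) → Set where
    tau   : ∀ {ρ S P} → S ∋ tau P → (ρ , sum S) ⟶ dirac (ρ , P)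
    op    : ∀ {ρ S P} {E : SuperOp m} {es} → S ∋ op E es P →
            (ρ , sum S) ⟶ dirac (applyOp E es ρ , P)
    meas  : ∀ {ρ S P Δ} {M : Measurement m l} {es} → S ∋ meas M es P →
            entries Δ ≡ outcomes M es ρ P → (ρ , sum S) ⟶ Δ
    commˡ : ∀ {ρ c v P P' Q Q'} → Out c v P P' → In c v Q Q' →
            (ρ , P ∥ Q) ⟶ dirac (ρ , P' ∥ Q')
    commʳ : ∀ {ρ c v P P' Q Q'} → In c v P P' → Out c v Q Q' →
            (ρ , P ∥ Q) ⟶ dirac (ρ , P' ∥ Q')
    parˡ  : ∀ {ρ P Q Δ} → (ρ , P) ⟶ Δ → (ρ , P ∥ Q) ⟶ mapᴰ (map₂ (_∥ Q)) Δ
    parʳ  : ∀ {ρ P Q Δ} → (ρ , Q) ⟶ Δ → (ρ , P ∥ Q) ⟶ mapᴰ (map₂ (P ∥_)) Δ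
    res   : ∀ {ρ P c Δ} → (ρ , P) ⟶ Δ → (ρ , P ∖ c) ⟶ mapᴰ (map₂ (_∖ c)) Δ
    iteᵗ  : ∀ {ρ e P Q Δ} → eval e ≡ true  → (ρ , P) ⟶ Δ → (ρ , ite e P Q) ⟶ Δ
    iteᶠ  : ∀ {ρ e P Q Δ} → eval e ≡ false → (ρ , Q) ⟶ Δ → (ρ , ite e P Q) ⟶ Δ

  -- The list collects the input channels; disjointness at ⊕ makes them distinct.
  data InputSum {n} {Γ : Vec Ty k} (Obs : ∀ {T} → Proc n (T ∷ Γ) → Set) :
                List Chan → Sum n Γ → Set where
    recv : ∀ {c R} → Obs R → InputSum Obs (c ∷ []) (recv c R)
    _⊕_  : ∀ {cs ds S T} → InputSum Obs cs S → InputSum Obs ds T → Disjoint cs ds →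
           InputSum Obs (cs ++ ds) (S ⊕ T)

  data Observer {k n} {Γ : Vec Ty k} : Proc n Γ → Set where
    discard : ∀ {es} → Observer (sum (discard es))
    op      : ∀ {R} {E : SuperOp m} {es} → Observer R → Observer (sum (op E es R))
    meas    : ∀ {R} {M : Measurement m l} {es} → Observer R → Observer (sum (meas M es R))
    send    : ∀ {c e} → Observer (sum (send c e))
    inputs  : ∀ {cs S} → InputSum Observer cs S → Observer (sum S)
    par     : ∀ {R R'} → Observer R → Observer R' → Observer (R ∥ R')
    ite     : ∀ {e R R'} → Observer R → Observer R' → Observer (ite e R R')

  data Conf (n : ℕ) : Set where
    ⟪_,_,_⟫ : State n → Proc n [] → Proc n [] → Conf n
    ⊥       : Conf n

  -- Σ collects the qubits of the process and of the observer together: it is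
  -- invariant under transitions, even when the two exchange qubits.  The
  -- remaining qubits of the state are available to contexts.
  _⊢ᶜ_ : Subset n → Conf n → Set
  Σ ⊢ᶜ ⟪ ρ , P , R ⟫ = IsDensity ρ × Observer R × (Σ ⊢ P ∥ R)
  Σ ⊢ᶜ ⊥             = ⊤

  _⊢ᴰ_ : Subset n → Dist (Conf n) → Set
  Σ ⊢ᴰ Δ = ∀ C → C ∈supp Δ → Σ ⊢ᶜ C

  mapObs : (Proc n [] → Proc n []) → Conf n → Conf n
  mapObs f ⟪ ρ , P , R ⟫ = ⟪ ρ , P , f R ⟫
  mapObs f ⊥             = ⊥

  -- The context O[·] = [·] ∥ R.
  _⟦_⟧ : Proc n [] → Dist (Conf n) → Dist (Conf n)
  R ⟦ Δ ⟧ = mapᴰ (mapObs (_∥ R)) Δ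

  data Move {n} : Conf n → Index → Dist (Conf n) → Set where
    process : ∀ {ρ P R Δ} → (ρ , P) ⟶ Δ →
              Move ⟪ ρ , P , R ⟫ ⋄ (mapᴰ (λ (ρ' , P') → ⟪ ρ' , P' , R ⟫) Δ)
    op      : ∀ {ρ P R} {E : SuperOp m} {es} →
              Move ⟪ ρ , P , sum (op E es R) ⟫ (path []) (dirac ⟪ applyOp E es ρ , P , R ⟫)
    meas    : ∀ {ρ P R Δ} {M : Measurement m l} {es} →
              entries Δ ≡ outcomes M es ρ R →
              Move ⟪ ρ , P , sum (meas M es R) ⟫ (path [])
                   (mapᴰ (λ (ρ' , R') → ⟪ ρ' , P , R' ⟫) Δ)
    recv    : ∀ {ρ P P' S c v R} → S ∋ recv c R → Out c v P P' →
              Move ⟪ ρ , P , sum S ⟫ (path []) (dirac ⟪ ρ , P' , R [ v ] ⟫)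
    send    : ∀ {ρ P P' c e} → In c (eval e) P P' →
              Move ⟪ ρ , P , sum (send c e) ⟫ (path []) (dirac ⟪ ρ , P' , sum (discard []) ⟫)
    parˡ    : ∀ {ρ P R R' π Δ} → Move ⟪ ρ , P , R ⟫ (path π) Δ →
              Move ⟪ ρ , P , R ∥ R' ⟫ (path (ℓ ∷ π)) (mapᴰ (mapObs (_∥ R')) Δ)
    parʳ    : ∀ {ρ P R R' π Δ} → Move ⟪ ρ , P , R' ⟫ (path π) Δ →
              Move ⟪ ρ , P , R ∥ R' ⟫ (path (r ∷ π)) (mapᴰ (mapObs (R ∥_)) Δ)
    iteᵗ    : ∀ {ρ P e R R' π Δ} → eval e ≡ true  → Move ⟪ ρ , P , R  ⟫ (path π) Δ →
              Move ⟪ ρ , P , ite e R R' ⟫ (path π) Δ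
    iteᶠ    : ∀ {ρ P e R R' π Δ} → eval e ≡ false → Move ⟪ ρ , P , R' ⟫ (path π) Δ →
              Move ⟪ ρ , P , ite e R R' ⟫ (path π) Δ

  data _⇝[_]_ {n} (C : Conf n) (π : Index) : Dist (Conf n) → Set where
    move     : ∀ {Δ} → Move C π Δ → C ⇝[ π ] Δ
    deadlock : (∀ Δ → ¬ Move C π Δ) → C ⇝[ π ] dirac ⊥

  -- The lifting to distributions: Δ = Σᵢ wᵢ • Cᵢ and Θ = Σᵢ wᵢ · Θᵢ with Cᵢ ⇝ Θᵢ.
  _⇝ᴰ[_]_ : Dist (Conf n) → Index → Dist (Conf n) → Set
  _⇝ᴰ[_]_ {n} Δ π Θ =
    Σ[ ts ∈ List (Real × (Conf n × Dist (Conf n))) ]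
      All (λ (w , (C , Ψ)) → 0# ≤ w × C ⇝[ π ] Ψ) ts
    × (∀ D → mass Δ D ≡ expect (λ (C , Ψ) → indicator (C ≡ D)) ts)
    × (∀ D → mass Θ D ≡ expect (λ (C , Ψ) → mass Ψ D) ts)

  data Barb : Set where
    ↓_ : Chan → Barb
    ↓⊥ : Barb

  Ready : Barb → Conf n → Set
  Ready     ↓⊥    C             = C ≡ ⊥
  Ready {n} (↓ c) ⟪ ρ , P , R ⟫ = Σ[ v ∈ Val n (ty c) ] (∃ (Out c v P) ⊎ ∃ (Out c v R))
  Ready     (↓ c) ⊥             = Empty

  Satisfies : Dist (Conf n) → Barb → Real → Set
  Satisfies Δ b p = Pr Δ (Ready b) ≡ p

  -- The subset indexing the relation is the common type of the two distributions.
  record IsBisimulation {n} (𝓡 : Subset n → Rel (Dist (Conf n)) 0ℓ) : Set where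
    field
      typed : ∀ {Σ Δ Θ} → 𝓡 Σ Δ Θ → Σ ⊢ᴰ Δ × Σ ⊢ᴰ Θ
      barbs : ∀ {Σ Δ Θ} → 𝓡 Σ Δ Θ → ∀ b p → Satisfies Δ b p ⇔ Satisfies Θ b p
      forth : ∀ {Σ Δ Θ} → 𝓡 Σ Δ Θ →
              ∀ {Σ' R} → Observer R → Σ' ⊢ R → Σ ∩ Σ' ≡ Subset.⊥ →
              ∀ {π Δ'} → R ⟦ Δ ⟧ ⇝ᴰ[ π ] Δ' →
              Σ[ Θ' ∈ Dist (Conf n) ] R ⟦ Θ ⟧ ⇝ᴰ[ π ] Θ' × 𝓡 (Σ ∪ Σ') Δ' Θ'
      back  : ∀ {Σ Δ Θ} → 𝓡 Σ Δ Θ →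
              ∀ {Σ' R} → Observer R → Σ' ⊢ R → Σ ∩ Σ' ≡ Subset.⊥ →
              ∀ {π Θ'} → R ⟦ Θ ⟧ ⇝ᴰ[ π ] Θ' →
              Σ[ Δ' ∈ Dist (Conf n) ] R ⟦ Δ ⟧ ⇝ᴰ[ π ] Δ' × 𝓡 (Σ ∪ Σ') Δ' Θ'

  -- Σ ⊢ Δ ∼cs Θ: the union of all bisimulations.
  _⊢_∼cs_ : Subset n → Rel (Dist (Conf n)) _
  _⊢_∼cs_ {n} Σ Δ Θ =
    Σ[ 𝓡 ∈ (Subset n → Rel (Dist (Conf n)) 0ℓ) ] IsBisimulation 𝓡 × 𝓡 Σ Δ Θ

-- The relation "Δ and Θ have the masses of p · Δ₁ + (1 - p) · Δ₂ and
-- p · Θ₁ + (1 - p) · Θ₂ for related Δᵢ, Θᵢ" is itself a bisimulation.  The point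
-- is that a move of the mixture splits into moves of Δ₁ and Δ₂: a family
-- Σⱼ wⱼ • (Cⱼ ⇝ Ψⱼ) witnessing it is reweighted by the densities
-- gᵢ(C) = Δᵢ(C) / Δ(C), which satisfy p g₁ + (1 - p) g₂ = 1.  If p is 0 or 1, one
-- of the Δᵢ has no density, but then any move of it will do, and one exists
-- because a configuration without a π-move deadlocks.
module Submission where

open import Defs
open import Level using (0ℓ)
open import Algebra.Bundles using (CommutativeRing)
open import Axiom.ExcludedMiddle using (ExcludedMiddle)
open import Data.Fin.Subset as Subset using (Subset)
open import Data.List as List using (List; []; _∷_; _++_)
import Data.List.Properties as ListP
open import Data.List.Relation.Unary.All as All using (All; []; _∷_)
import Data.List.Relation.Unary.All.Properties as AllP
open import Data.Nat as ℕ using (ℕ; suc)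
import Data.Nat.Properties as ℕ
open import Data.Product using (∃; Σ-syntax; _×_; _,_; proj₁; proj₂; map₂)
open import Data.Sum using (inj₁; inj₂)
open import Data.Vec using ([])
open import Function using (_∘_; mk⇔; flip; module Equivalence)
open import Relation.Binary.Core using (Rel)
open import Relation.Binary.PropositionalEquality
  using (_≡_; _≢_; refl; sym; trans; cong; cong₂; subst; module ≡-Reasoning)
open import Relation.Binary.Structures using (IsTotalOrder)
open import Relation.Nullary using (¬?; yes; no; contradiction)

module _ (em : ExcludedMiddle 0ℓ) (ℝ : Reals) where

  open Reals ℝ renaming (Carrier to Real)

  commutativeRing : CommutativeRing 0ℓ 0ℓ
  commutativeRing = record { isCommutativeRing = isCommutativeRing }

  open CommutativeRing commutativeRing
    using (ring; commutativeSemiring; *-assoc; *-identityˡ; zeroˡ)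
  open import Algebra.Properties.Ring ring
    using (-1*x≈-x; +-cancelʳ; -‿distribˡ-*; -‿distribʳ-*; -‿involutive)
  open import Algebra.Solver.Ring.NaturalCoefficients.Default commutativeSemiring
    using (solve; _:+_; _:*_; _:=_)
  open IsTotalOrder isTotalOrder using ()
    renaming (trans to ≤-trans; antisym to ≤-antisym; reflexive to ≤-reflexive)
  open LqCCS em ℝ
    using ( Dist; dist; entries; nonneg; total; weight; expect; indicator; Pr; mass
          ; 0≤1; 0≤1-p; p+[1-p]≡1; scaleEntries; nonneg-scale; dirac; mix
          ; Proc; _∥_; Observer; Conf; Ready; ⊥; Move; move; deadlock; mapObs; _⟦_⟧; _⇝[_]_; _⇝ᴰ[_]_
          ; _⊢_; _⊢ᴰ_; IsBisimulation)
  open ≡-Reasoning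

  private variable
    A B : Set
    n   : ℕ

  -- Ordered-field arithmetic and densities.

  +-nonneg : ∀ {x y} → 0# ≤ x → 0# ≤ y → 0# ≤ x + y
  +-nonneg {x} {y} 0≤x 0≤y =
    ≤-trans 0≤y (subst (_≤ x + y) (+-identityˡ y) (+-monoˡ-≤ y 0≤x))

  x≤0⇒0≤-x : ∀ {x} → x ≤ 0# → 0# ≤ - x
  x≤0⇒0≤-x {x} x≤0 = subst (_≤ - x) (-‿inverseʳ x)
    (subst (x + - x ≤_) (+-identityˡ (- x)) (+-monoˡ-≤ (- x) x≤0))

  square-nonneg : ∀ x → 0# ≤ x * x
  square-nonneg x with ≤-total 0# x
  ... | inj₁ 0≤x = *-nonneg 0≤x 0≤x
  ... | inj₂ x≤0 = subst (0# ≤_) -x*-x≡x*x (*-nonneg (x≤0⇒0≤-x x≤0) (x≤0⇒0≤-x x≤0))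
    where
    -x*-x≡x*x : (- x) * (- x) ≡ x * x
    -x*-x≡x*x = begin
      (- x) * (- x)  ≡⟨ -‿distribˡ-* x (- x) ⟨
      - (x * (- x))  ≡⟨ cong -_ (-‿distribʳ-* x x) ⟨
      - (- (x * x))  ≡⟨ -‿involutive (x * x) ⟩
      x * x          ∎

  -- The inverse equals `x` times its own square, a product of nonnegative factors.
  ⁻¹-nonneg : ∀ {x} → 0# ≤ x → x ≢ 0# → 0# ≤ x ⁻¹
  ⁻¹-nonneg {x} 0≤x x≢0 = subst (0# ≤_) x*x⁻²≡x⁻¹ (*-nonneg 0≤x (square-nonneg (x ⁻¹)))
    where
    x*x⁻²≡x⁻¹ : x * (x ⁻¹ * x ⁻¹) ≡ x ⁻¹
    x*x⁻²≡x⁻¹ = begin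
      x * (x ⁻¹ * x ⁻¹)  ≡⟨ *-assoc x _ _ ⟨
      x * x ⁻¹ * x ⁻¹    ≡⟨ cong (_* x ⁻¹) (⁻¹-inverseʳ x≢0) ⟩
      1# * x ⁻¹          ≡⟨ *-identityˡ _ ⟩
      x ⁻¹               ∎

  x+y≡0⇒x≡0 : ∀ {x y} → 0# ≤ x → 0# ≤ y → x + y ≡ 0# → x ≡ 0#
  x+y≡0⇒x≡0 {x} {y} 0≤x 0≤y x+y≡0 = ≤-antisym
    (subst (x ≤_) (trans (+-comm y x) x+y≡0)
      (subst (_≤ y + x) (+-identityˡ x) (+-monoˡ-≤ x 0≤y)))
    0≤x

  x*y≡0⇒y≡0 : ∀ {x y} → x ≢ 0# → x * y ≡ 0# → y ≡ 0#
  x*y≡0⇒y≡0 {x} {y} x≢0 x*y≡0 = begin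
    y               ≡⟨ *-identityˡ y ⟨
    1# * y          ≡⟨ cong (_* y) (⁻¹-inverseʳ x≢0) ⟨
    x * x ⁻¹ * y    ≡⟨ solve 3 (λ x i y → x :* i :* y := i :* (x :* y)) refl x (x ⁻¹) y ⟩
    x ⁻¹ * (x * y)  ≡⟨ cong (x ⁻¹ *_) x*y≡0 ⟩
    x ⁻¹ * 0#       ≡⟨ zeroʳ _ ⟩
    0#              ∎

  -- The value at m ≡ 0# makes the two densities of a mixture average to 1#
  -- even outside its support.
  density : Real → Real → Real
  density m₁ m with em {m ≡ 0#}
  ... | yes _ = 1#
  ... | no  _ = m₁ * m ⁻¹

  density-nonneg : ∀ {m₁ m} → 0# ≤ m₁ → 0# ≤ m → 0# ≤ density m₁ m
  density-nonneg {m = m} 0≤m₁ 0≤m with em {m ≡ 0#}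
  ... | yes _   = 0≤1
  ... | no  m≢0 = *-nonneg 0≤m₁ (⁻¹-nonneg 0≤m m≢0)

  -- The premise is absolute continuity. It is what makes the default density `1#` correct at
  -- `m ≡ 0#`, where both sides vanish.
  density-* : ∀ {m₁ m} → (m ≡ 0# → m₁ ≡ 0#) → m₁ ≡ density m₁ m * m
  density-* {m₁} {m} m≡0⇒m₁≡0 with em {m ≡ 0#}
  ... | yes m≡0 = trans (m≡0⇒m₁≡0 m≡0) (sym (trans (*-identityˡ m) m≡0))
  ... | no  m≢0 = begin
    m₁              ≡⟨ *-identityʳ m₁ ⟨
    m₁ * 1#         ≡⟨ cong (m₁ *_) (⁻¹-inverseʳ m≢0) ⟨
    m₁ * (m * m ⁻¹) ≡⟨ solve 3 (λ a m i → a :* (m :* i) := a :* i :* m) refl m₁ m (m ⁻¹) ⟩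
    m₁ * m ⁻¹ * m   ∎

  density-mix : ∀ {p q m₁ m₂ m} → p + q ≡ 1# → m ≡ p * m₁ + q * m₂ →
                p * density m₁ m + q * density m₂ m ≡ 1#
  density-mix {p} {q} {m₁} {m₂} {m} p+q≡1 m≡ with em {m ≡ 0#}
  ... | yes _   = trans (cong₂ _+_ (*-identityʳ p) (*-identityʳ q)) p+q≡1
  ... | no  m≢0 = begin
    p * (m₁ * m ⁻¹) + q * (m₂ * m ⁻¹) ≡⟨ solve 5 (λ p a q b i → p :* (a :* i) :+ q :* (b :* i)
                                                 := (p :* a :+ q :* b) :* i) refl p m₁ q m₂ (m ⁻¹) ⟩
    (p * m₁ + q * m₂) * m ⁻¹          ≡⟨ cong (_* m ⁻¹) m≡ ⟨
    m * m ⁻¹                          ≡⟨ ⁻¹-inverseʳ m≢0 ⟩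
    1#                                ∎

  -- Expectations over weighted lists.

  indicator-nonneg : ∀ P → 0# ≤ indicator P
  indicator-nonneg P with em {P}
  ... | yes _ = 0≤1
  ... | no  _ = ≤-reflexive refl

  *-indicator-≡ : (f : A → Real) (a b : A) → f a * indicator (a ≡ b) ≡ f b * indicator (a ≡ b)
  *-indicator-≡ f a b with em {a ≡ b}
  ... | yes refl = refl
  ... | no  _    = trans (zeroʳ (f a)) (sym (zeroʳ (f b)))

  expect-cong : {f g : A → Real} → (∀ a → f a ≡ g a) → ∀ xs → expect f xs ≡ expect g xs
  expect-cong f≗g []             = refl
  expect-cong f≗g ((w , a) ∷ xs) = cong₂ _+_ (cong (w *_) (f≗g a)) (expect-cong f≗g xs)

  expect-++ : (f : A → Real) → ∀ xs ys → expect f (xs ++ ys) ≡ expect f xs + expect f ys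
  expect-++ f []             ys = sym (+-identityˡ _)
  expect-++ f ((w , a) ∷ xs) ys = trans (cong (w * f a +_) (expect-++ f xs ys)) (sym (+-assoc _ _ _))

  expect-scale : (f : A → Real) → ∀ p xs → expect f (scaleEntries p xs) ≡ p * expect f xs
  expect-scale f p []             = sym (zeroʳ p)
  expect-scale f p ((w , a) ∷ xs) =
    trans (cong₂ _+_ (*-assoc p w (f a)) (expect-scale f p xs)) (sym (distribˡ p _ _))

  expect-map₂ : (f : B → Real) (h : A → B) → ∀ xs →
                expect f (List.map (map₂ h) xs) ≡ expect (f ∘ h) xs
  expect-map₂ f h []             = refl
  expect-map₂ f h ((w , a) ∷ xs) = cong (w * f (h a) +_) (expect-map₂ f h xs)

  expect-+ : (f g : A → Real) → ∀ xs → expect (λ a → f a + g a) xs ≡ expect f xs + expect g xs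
  expect-+ f g []             = sym (+-identityˡ 0#)
  expect-+ f g ((w , a) ∷ xs) = trans (cong (w * (f a + g a) +_) (expect-+ f g xs))
    (solve 5 (λ w x y s t → w :* (x :+ y) :+ (s :+ t) := (w :* x :+ s) :+ (w :* y :+ t)) refl
       w (f a) (g a) (expect f xs) (expect g xs))

  expect-* : (f : A → Real) → ∀ c xs → expect (λ a → c * f a) xs ≡ c * expect f xs
  expect-* f c []             = sym (zeroʳ c)
  expect-* f c ((w , a) ∷ xs) = trans (cong (w * (c * f a) +_) (expect-* f c xs))
    (solve 4 (λ w c x s → w :* (c :* x) :+ c :* s := c :* (w :* x :+ s)) refl
       w c (f a) (expect f xs))

  expect-nonneg : {f : A → Real} → (∀ a → 0# ≤ f a) →
                  ∀ {xs} → All (λ e → 0# ≤ proj₁ e) xs → 0# ≤ expect f xs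
  expect-nonneg 0≤f []                     = ≤-reflexive refl
  expect-nonneg 0≤f (_∷_ {x = _ , a} 0≤w nn) = +-nonneg (*-nonneg 0≤w (0≤f a)) (expect-nonneg 0≤f nn)

  weight≡expect-1 : (xs : List (Real × A)) → weight xs ≡ expect (λ _ → 1#) xs
  weight≡expect-1 []             = refl
  weight≡expect-1 ((w , _) ∷ xs) = cong₂ _+_ (sym (*-identityʳ w)) (weight≡expect-1 xs)

  reweight : (A → Real) → List (Real × A) → List (Real × A)
  reweight g = List.map (λ (w , a) → w * g a , a)

  expect-reweight : (f g : A → Real) → ∀ xs → expect f (reweight g xs) ≡ expect (λ a → g a * f a) xs
  expect-reweight f g []             = refl
  expect-reweight f g ((w , a) ∷ xs) = cong₂ _+_ (*-assoc w _ _) (expect-reweight f g xs)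

  delete : A → List (Real × A) → List (Real × A)
  delete a = List.filter (λ (_ , b) → ¬? (em {b ≡ a}))

  -- An element may occur several times in the list, so all its occurrences are collected at once:
  -- their common value `f a` factors out, and what remains of their weights is the mass of `a`.
  expect-delete : (f : A → Real) (a : A) → ∀ xs →
    expect f xs ≡ f a * expect (λ b → indicator (b ≡ a)) xs + expect f (delete a xs)
  expect-delete f a [] = sym (trans (+-identityʳ _) (zeroʳ (f a)))
  expect-delete f a ((w , b) ∷ xs) with em {b ≡ a}
  ... | yes refl = trans (cong (w * f a +_) (expect-delete f a xs))
    (trans (sym (+-assoc _ _ _)) (cong (_+ expect f (delete a xs)) (begin
      w * f a + f a * m         ≡⟨ cong (_+ f a * m) (cong (_* f a) (sym (*-identityʳ w))) ⟩
      w * 1# * f a + f a * m    ≡⟨ solve 4 (λ w u x m → w :* u :* x :+ x :* m := x :* (w :* u :+ m)) refl w 1# (f a) m ⟩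
      f a * (w * 1# + m)        ∎)))
    where m = expect (λ b → indicator (b ≡ a)) xs
  ... | no  _    = trans (cong (w * f b +_) (expect-delete f a xs))
    (trans (solve 3 (λ x y z → x :+ (y :+ z) := y :+ (x :+ z)) refl (w * f b) (f a * m) (expect f (delete a xs)))
      (cong (_+ (w * f b + expect f (delete a xs))) (cong (f a *_)
        (sym (trans (cong (_+ m) (zeroʳ w)) (+-identityˡ m))))))
    where m = expect (λ b → indicator (b ≡ a)) xs

  -- Weights may be negative here, so that the difference of two distributions
  -- is covered.
  expect-null : (f : A → Real) → ∀ xs → (∀ a → expect (λ b → indicator (b ≡ a)) xs ≡ 0#) →
                expect f xs ≡ 0#
  expect-null {A} f xs null = go (List.length xs) xs ℕ.≤-refl null
    where
    -- `delete a xs` is not a structural sublist of `xs`, so the recursion runs on a bound `k` for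
    -- the length. As `a` has mass `0#`, deleting it changes no expectation; applied to the
    -- indicators, this shows that the shorter list is null again.
    go : ∀ k (xs : List (Real × A)) → List.length xs ℕ.≤ k →
         (∀ a → expect (λ b → indicator (b ≡ a)) xs ≡ 0#) → expect f xs ≡ 0#
    go k       []                      _           _    = refl
    go (suc k) xs@((w , a) ∷ xs') (ℕ.s≤s ∣xs'∣≤k) null =
      trans (split f) (go k (delete a xs) shorter (λ b → trans (sym (split _)) (null b)))
      where
      split : (h : A → Real) → expect h xs ≡ expect h (delete a xs)
      split h = trans (expect-delete h a xs)
        (trans (cong (_+ expect h (delete a xs)) (trans (cong (h a *_) (null a)) (zeroʳ (h a))))
          (+-identityˡ _))
      -- The filter reduces at the head only once `em` has decided `a ≡ a`; the head is then
      -- dropped, and filtering does not lengthen the tail.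
      shorter : List.length (delete a xs) ℕ.≤ k
      shorter with em {a ≡ a}
      ... | yes _  = ℕ.≤-trans (ListP.length-filter (λ (_ , b) → ¬? (em {b ≡ a})) xs') ∣xs'∣≤k
      ... | no a≢a = contradiction refl a≢a

  -- The formal difference of the two lists is null, so every expectation over it vanishes. This
  -- makes expectations independent of how a distribution is written as a formal combination.
  expect-cong-mass : (f : A → Real) → ∀ xs ys →
    (∀ a → expect (λ b → indicator (b ≡ a)) xs ≡ expect (λ b → indicator (b ≡ a)) ys) →
    expect f xs ≡ expect f ys
  expect-cong-mass {A} f xs ys xs≋ys = +-cancelʳ (- expect f ys) _ _
    (trans (trans (sym (difference f)) (expect-null f zs null)) (sym (-‿inverseʳ _)))
    where
    zs = xs ++ scaleEntries (- 1#) ys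
    difference : (h : A → Real) → expect h zs ≡ expect h xs - expect h ys
    difference h = trans (expect-++ h xs _)
      (cong (expect h xs +_) (trans (expect-scale h (- 1#) ys) (-1*x≈-x _)))
    null : ∀ a → expect (λ b → indicator (b ≡ a)) zs ≡ 0#
    null a = trans (difference _) (trans (cong (_- _) (xs≋ys a)) (-‿inverseʳ _))

  -- The multiplication of the distribution monad, with the source component of each transition
  -- forgotten.
  flatten : List (Real × (B × Dist A)) → List (Real × A)
  flatten []                 = []
  flatten ((w , _ , Ψ) ∷ ts) = scaleEntries w (entries Ψ) ++ flatten ts

  flatten-nonneg : {ts : List (Real × (B × Dist A))} → All (λ t → 0# ≤ proj₁ t) ts →
                   All (λ e → 0# ≤ proj₁ e) (flatten ts)
  flatten-nonneg []                           = []
  flatten-nonneg (_∷_ {x = _ , _ , Ψ} 0≤w nn) =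
    AllP.++⁺ (nonneg-scale 0≤w (nonneg Ψ)) (flatten-nonneg nn)

  expect-flatten : (f : A → Real) (ts : List (Real × (B × Dist A))) →
                   expect f (flatten ts) ≡ expect (λ (_ , Ψ) → expect f (entries Ψ)) ts
  expect-flatten f []                 = refl
  expect-flatten f ((w , _ , Ψ) ∷ ts) = trans (expect-++ f (scaleEntries w (entries Ψ)) _)
    (cong₂ _+_ (expect-scale f w (entries Ψ)) (expect-flatten f ts))

  -- Distributions up to equality of masses.

  infix 4 _≈_
  _≈_ : Rel (Dist A) 0ℓ
  Δ ≈ Θ = ∀ a → mass Δ a ≡ mass Θ a

  Pr-cong : (Δ Θ : Dist A) → Δ ≈ Θ → ∀ P → Pr Δ P ≡ Pr Θ P
  Pr-cong Δ Θ Δ≈Θ P = expect-cong-mass _ (entries Δ) (entries Θ) Δ≈Θ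

  mass-nonneg : (Δ : Dist A) → ∀ a → 0# ≤ mass Δ a
  mass-nonneg Δ a = expect-nonneg (λ b → indicator-nonneg (b ≡ a)) (nonneg Δ)

  -- Weighted families of transitions.

  Moves : Index → List (Real × (Conf n × Dist (Conf n))) → Set
  Moves π = All (λ (w , (C , Ψ)) → 0# ≤ w × C ⇝[ π ] Ψ)

  Sources : Dist (Conf n) → List (Real × (Conf n × Dist (Conf n))) → Set
  Sources Δ ts = ∀ D → mass Δ D ≡ expect (λ (C , Ψ) → indicator (C ≡ D)) ts

  Targets : Dist (Conf n) → List (Real × (Conf n × Dist (Conf n))) → Set
  Targets Θ ts = ∀ D → mass Θ D ≡ expect (λ (C , Ψ) → mass Ψ D) ts

  -- The flattened family has total weight `1#` because every `Ψ` has, and because the weights of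
  -- the sources add up to those of `Δ`.
  target : ∀ {π} (Δ : Dist (Conf n)) ts → Moves π ts → Sources Δ ts → ∃ λ Θ → Targets Θ ts
  target Δ ts moves sources =
    dist (flatten ts) (flatten-nonneg (All.map proj₁ moves)) weight≡1 ,
    λ D → expect-flatten _ ts
    where
    weight≡1 : weight (flatten ts) ≡ 1#
    weight≡1 = begin
      weight (flatten ts)                                   ≡⟨ weight≡expect-1 (flatten ts) ⟩
      expect (λ _ → 1#) (flatten ts)                        ≡⟨ expect-flatten _ ts ⟩
      expect (λ (_ , Ψ) → expect (λ _ → 1#) (entries Ψ)) ts ≡⟨ expect-cong (λ (_ , Ψ) →
                                                                 trans (sym (weight≡expect-1 (entries Ψ))) (total Ψ)) ts ⟩
      -- `Sources` speaks of masses only. To get the total weight, the list of sources is compared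
      -- with `Δ` through the expectation of the constant `1#`.
      expect (λ _ → 1#) ts                                  ≡⟨ expect-map₂ _ proj₁ ts ⟨
      expect (λ _ → 1#) (List.map (map₂ proj₁) ts)          ≡⟨ expect-cong-mass _ (List.map (map₂ proj₁) ts) (entries Δ)
                                                                 (λ D → trans (expect-map₂ _ proj₁ ts) (sym (sources D))) ⟩
      expect (λ _ → 1#) (entries Δ)                         ≡⟨ weight≡expect-1 (entries Δ) ⟨
      weight (entries Δ)                                    ≡⟨ total Δ ⟩
      1#                                                    ∎

  -- Excluded middle on the existence of a move; the negative case is the premise of `deadlock`.
  ⇝-total : ∀ π (C : Conf n) → ∃ (C ⇝[ π ]_)
  ⇝-total π C with em {∃ (Move C π)}
  ... | yes (Ψ , m) = Ψ , move m
  ... | no  ¬m      = dirac ⊥ , deadlock (λ Ψ m → ¬m (Ψ , m))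

  ⇝ᴰ-total : ∀ π (Δ : Dist (Conf n)) → ∃ (Δ ⇝ᴰ[ π ]_)
  ⇝ᴰ-total {n} π Δ = proj₁ Θ,targets , ts , moves , sources , proj₂ Θ,targets
    where
    branch : Conf n → Conf n × Dist (Conf n)
    branch C = C , proj₁ (⇝-total π C)
    ts        = List.map (map₂ branch) (entries Δ)
    moves     : Moves π ts
    moves     = AllP.map⁺ (All.map (λ {(w , C)} 0≤w → 0≤w , proj₂ (⇝-total π C)) (nonneg Δ))
    sources   : Sources Δ ts
    sources D = sym (expect-map₂ _ branch (entries Δ))
    Θ,targets = target Δ ts moves sources

  reweight-moves : ∀ {π} (g : Conf n → Real) (ts : List (Real × (Conf n × Dist (Conf n)))) →
                   (∀ C → 0# ≤ g C) → Moves π ts → Moves π (reweight (g ∘ proj₁) ts)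
  reweight-moves g ts 0≤g =
    AllP.map⁺ ∘ All.map (λ {(w , (C , Ψ))} (0≤w , m) → *-nonneg 0≤w (0≤g C) , m)

  -- The factor `g` depends on the source alone, so it is the constant `g D` on all transitions that
  -- contribute to the mass of `D`.
  reweight-sources : (g : Conf n → Real) (Δ Δ₁ : Dist (Conf n)) → ∀ ts →
                     (∀ C → mass Δ₁ C ≡ g C * mass Δ C) →
                     Sources Δ ts → Sources Δ₁ (reweight (g ∘ proj₁) ts)
  reweight-sources g Δ Δ₁ ts Δ₁≡gΔ sources D = begin
    mass Δ₁ D                                                ≡⟨ Δ₁≡gΔ D ⟩
    g D * mass Δ D                                           ≡⟨ cong (g D *_) (sources D) ⟩
    g D * expect (λ (C , Ψ) → indicator (C ≡ D)) ts          ≡⟨ expect-* _ (g D) ts ⟨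
    expect (λ (C , Ψ) → g D * indicator (C ≡ D)) ts          ≡⟨ expect-cong (λ (C , Ψ) → *-indicator-≡ g C D) ts ⟨
    expect (λ (C , Ψ) → g C * indicator (C ≡ D)) ts          ≡⟨ expect-reweight _ (g ∘ proj₁) ts ⟨
    expect (λ (C , Ψ) → indicator (C ≡ D)) (reweight (g ∘ proj₁) ts) ∎

  TypedRel : ℕ → Set₁
  TypedRel n = Subset n → Rel (Dist (Conf n)) 0ℓ

  converse : TypedRel n → TypedRel n
  converse 𝓡 Σ = flip (𝓡 Σ)

  -- The `forth` clause in isolation. The `back` clause is the same one for `converse 𝓡`, so a
  -- single argument serves both directions.
  Simulation : TypedRel n → Set
  Simulation {n} 𝓡 = ∀ {Σ Δ Θ} → 𝓡 Σ Δ Θ →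
    ∀ {Σ' R} → Observer R → Σ' ⊢ R → Σ Subset.∩ Σ' ≡ Subset.⊥ →
    ∀ {π Δ'} → R ⟦ Δ ⟧ ⇝ᴰ[ π ] Δ' →
    Σ[ Θ' ∈ Dist (Conf n) ] R ⟦ Θ ⟧ ⇝ᴰ[ π ] Θ' × 𝓡 (Σ Subset.∪ Σ') Δ' Θ'

  -- Splitting and recombining moves of a mixture.

  module _ (p : Real) (0≤p : 0# ≤ p) (p≤1 : p ≤ 1#) where

    mixᵖ : Dist A → Dist A → Dist A
    mixᵖ = mix p 0≤p p≤1

    q : Real
    q = 1# - p

    0≤q : 0# ≤ q
    0≤q = 0≤1-p p≤1

    expect-mix : (f : A → Real) → ∀ xs ys →
                 expect f (scaleEntries p xs ++ scaleEntries q ys) ≡ p * expect f xs + q * expect f ys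
    expect-mix f xs ys = trans (expect-++ f (scaleEntries p xs) _)
      (cong₂ _+_ (expect-scale f p xs) (expect-scale f q ys))

    -- The mass of `D` after plugging into the context is the probability of the preimage of `D`,
    -- and probabilities of events respect `≈` and are affine in the mixture.
    ⟦⟧-mix : (R : Proc n []) (Δ Δ₁ Δ₂ : Dist (Conf n)) → Δ ≈ mixᵖ Δ₁ Δ₂ →
             R ⟦ Δ ⟧ ≈ mixᵖ (R ⟦ Δ₁ ⟧) (R ⟦ Δ₂ ⟧)
    ⟦⟧-mix R Δ Δ₁ Δ₂ Δ≈ D = begin
      mass (R ⟦ Δ ⟧) D                              ≡⟨ expect-map₂ _ in-R (entries Δ) ⟩
      Pr Δ E                                        ≡⟨ Pr-cong Δ (mixᵖ Δ₁ Δ₂) Δ≈ E ⟩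
      Pr (mixᵖ Δ₁ Δ₂) E                             ≡⟨ expect-mix _ (entries Δ₁) (entries Δ₂) ⟩
      p * Pr Δ₁ E + q * Pr Δ₂ E                     ≡⟨ cong₂ (λ x y → p * x + q * y)
                                                         (expect-map₂ _ in-R (entries Δ₁))
                                                         (expect-map₂ _ in-R (entries Δ₂)) ⟨
      p * mass (R ⟦ Δ₁ ⟧) D + q * mass (R ⟦ Δ₂ ⟧) D ≡⟨ expect-mix _ (entries (R ⟦ Δ₁ ⟧)) (entries (R ⟦ Δ₂ ⟧)) ⟨
      mass (mixᵖ (R ⟦ Δ₁ ⟧) (R ⟦ Δ₂ ⟧)) D           ∎
      where
      in-R = mapObs (_∥ R)
      E    = λ C → in-R C ≡ D

    -- The two families are scaled and concatenated. A configuration may then occur with different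
    -- transitions in the two halves, which the lifting permits.
    ⇝ᴰ-mix : ∀ {π} (Θ Θ₁ Θ₂ Θ₁' Θ₂' : Dist (Conf n)) → Θ ≈ mixᵖ Θ₁ Θ₂ →
             Θ₁ ⇝ᴰ[ π ] Θ₁' → Θ₂ ⇝ᴰ[ π ] Θ₂' → Θ ⇝ᴰ[ π ] mixᵖ Θ₁' Θ₂'
    ⇝ᴰ-mix Θ Θ₁ Θ₂ Θ₁' Θ₂' Θ≈ (ts₁ , moves₁ , sources₁ , targets₁) (ts₂ , moves₂ , sources₂ , targets₂) =
      scaleEntries p ts₁ ++ scaleEntries q ts₂ ,
      AllP.++⁺ (scale-moves 0≤p moves₁) (scale-moves 0≤q moves₂) ,
      (λ D → trans (Θ≈ D) (trans (expect-mix _ (entries Θ₁) (entries Θ₂))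
        (trans (cong₂ (λ x y → p * x + q * y) (sources₁ D) (sources₂ D))
          (sym (expect-mix _ ts₁ ts₂))))) ,
      (λ D → trans (expect-mix _ (entries Θ₁') (entries Θ₂'))
        (trans (cong₂ (λ x y → p * x + q * y) (targets₁ D) (targets₂ D))
          (sym (expect-mix _ ts₁ ts₂))))
      where
      scale-moves : ∀ {π s} {ts : List (Real × (Conf n × Dist (Conf n)))} →
                    0# ≤ s → Moves π ts → Moves π (scaleEntries s ts)
      scale-moves 0≤s = AllP.map⁺ ∘ All.map (λ {(w , _)} (0≤w , m) → *-nonneg 0≤s 0≤w , m)

    -- For `p` and `q` nonzero, both components use the same transitions as the mixture and differ
    -- only in the weights, so that averaging the weights recovers `Δ'`.
    ⇝ᴰ-unmix : ∀ {π} (Δ Δ₁ Δ₂ Δ' : Dist (Conf n)) → Δ ≈ mixᵖ Δ₁ Δ₂ → Δ ⇝ᴰ[ π ] Δ' →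
               Σ[ Δ₁' ∈ Dist (Conf n) ] Σ[ Δ₂' ∈ Dist (Conf n) ]
                 Δ₁ ⇝ᴰ[ π ] Δ₁' × Δ₂ ⇝ᴰ[ π ] Δ₂' × Δ' ≈ mixᵖ Δ₁' Δ₂'
    ⇝ᴰ-unmix {n} {π} Δ Δ₁ Δ₂ Δ' Δ≈ (ts , moves , sources , targets)
      with em {p ≡ 0#} | em {q ≡ 0#}
    -- Here `Δ` has the masses of `Δ₂`, which takes over the whole family `ts`; the target chosen
    -- for `Δ₁` enters the mixture with coefficient `0#`. The case `q ≡ 0#` is symmetric.
    ... | yes p≡0 | _ =
      Δ₁' , Δ' , Δ₁⇝ , (ts , moves , (λ D → trans (sym (mixture D)) (sources D)) , targets) ,
      λ D → sym (trans (expect-mix _ (entries Δ₁') (entries Δ')) (collapse _ _))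
      where
      Δ₁' = proj₁ (⇝ᴰ-total π Δ₁)
      Δ₁⇝ = proj₂ (⇝ᴰ-total π Δ₁)
      q≡1 : q ≡ 1#
      q≡1 = trans (sym (+-identityˡ q)) (trans (cong (_+ q) (sym p≡0)) (p+[1-p]≡1 p))
      collapse : ∀ x y → p * x + q * y ≡ y
      collapse x y = trans (cong₂ _+_ (trans (cong (_* x) p≡0) (zeroˡ x))
                                      (trans (cong (_* y) q≡1) (*-identityˡ y)))
                           (+-identityˡ y)
      mixture : Δ ≈ Δ₂
      mixture D = trans (Δ≈ D) (trans (expect-mix _ (entries Δ₁) (entries Δ₂)) (collapse _ _))
    ... | no _ | yes q≡0 =
      Δ' , Δ₂' , (ts , moves , (λ D → trans (sym (mixture D)) (sources D)) , targets) , Δ₂⇝ ,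
      λ D → sym (trans (expect-mix _ (entries Δ') (entries Δ₂')) (collapse _ _))
      where
      Δ₂' = proj₁ (⇝ᴰ-total π Δ₂)
      Δ₂⇝ = proj₂ (⇝ᴰ-total π Δ₂)
      p≡1 : p ≡ 1#
      p≡1 = trans (sym (+-identityʳ p)) (trans (cong (p +_) (sym q≡0)) (p+[1-p]≡1 p))
      collapse : ∀ x y → p * x + q * y ≡ x
      collapse x y = trans (cong₂ _+_ (trans (cong (_* x) p≡1) (*-identityˡ x))
                                      (trans (cong (_* y) q≡0) (zeroˡ y)))
                           (+-identityʳ x)
      mixture : Δ ≈ Δ₁
      mixture D = trans (Δ≈ D) (trans (expect-mix _ (entries Δ₁) (entries Δ₂)) (collapse _ _))
    ... | no p≢0 | no q≢0 =
      proj₁ Δ₁'+ , proj₁ Δ₂'+ ,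
      (ts₁ , moves₁ , sources₁ , proj₂ Δ₁'+) , (ts₂ , moves₂ , sources₂ , proj₂ Δ₂'+) , recombine
      where
      mixture : ∀ C → mass Δ C ≡ p * mass Δ₁ C + q * mass Δ₂ C
      mixture C = trans (Δ≈ C) (expect-mix _ (entries Δ₁) (entries Δ₂))
      g₁ g₂ : Conf n → Real
      g₁ C = density (mass Δ₁ C) (mass Δ C)
      g₂ C = density (mass Δ₂ C) (mass Δ C)
      -- Absolute continuity: two nonnegative summands with sum `0#` both vanish, and the
      -- coefficient `p` can be cancelled since it is nonzero.
      Δ≡0⇒Δ₁≡0 : ∀ C → mass Δ C ≡ 0# → mass Δ₁ C ≡ 0#
      Δ≡0⇒Δ₁≡0 C Δ≡0 = x*y≡0⇒y≡0 p≢0 (x+y≡0⇒x≡0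
        (*-nonneg 0≤p (mass-nonneg Δ₁ C)) (*-nonneg 0≤q (mass-nonneg Δ₂ C))
        (trans (sym (mixture C)) Δ≡0))
      Δ≡0⇒Δ₂≡0 : ∀ C → mass Δ C ≡ 0# → mass Δ₂ C ≡ 0#
      Δ≡0⇒Δ₂≡0 C Δ≡0 = x*y≡0⇒y≡0 q≢0 (x+y≡0⇒x≡0
        (*-nonneg 0≤q (mass-nonneg Δ₂ C)) (*-nonneg 0≤p (mass-nonneg Δ₁ C))
        (trans (+-comm _ _) (trans (sym (mixture C)) Δ≡0)))
      ts₁ = reweight (g₁ ∘ proj₁) ts
      ts₂ = reweight (g₂ ∘ proj₁) ts
      moves₁ : Moves π ts₁
      moves₁ = reweight-moves g₁ ts (λ C → density-nonneg (mass-nonneg Δ₁ C) (mass-nonneg Δ C)) moves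
      moves₂ : Moves π ts₂
      moves₂ = reweight-moves g₂ ts (λ C → density-nonneg (mass-nonneg Δ₂ C) (mass-nonneg Δ C)) moves
      sources₁ : Sources Δ₁ ts₁
      sources₁ = reweight-sources g₁ Δ Δ₁ ts (λ C → density-* (Δ≡0⇒Δ₁≡0 C)) sources
      sources₂ : Sources Δ₂ ts₂
      sources₂ = reweight-sources g₂ Δ Δ₂ ts (λ C → density-* (Δ≡0⇒Δ₂≡0 C)) sources
      Δ₁'+ = target Δ₁ ts₁ moves₁ sources₁
      Δ₂'+ = target Δ₂ ts₂ moves₂ sources₂
      recombine : Δ' ≈ mixᵖ (proj₁ Δ₁'+) (proj₁ Δ₂'+)
      recombine D = begin
        mass Δ' D
          ≡⟨ targets D ⟩
        expect h ts
          -- Each term is multiplied by `p * g₁ C + q * g₂ C`, which is `1#` by `density-mix`.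
          ≡⟨ expect-cong (λ (C , Ψ) → trans
               (solve 5 (λ p a q b x → p :* (a :* x) :+ q :* (b :* x) := (p :* a :+ q :* b) :* x) refl
                  p (g₁ C) q (g₂ C) (mass Ψ D))
               (trans (cong (_* mass Ψ D) (density-mix (p+[1-p]≡1 p) (mixture C))) (*-identityˡ _))) ts ⟨
        expect (λ t → p * (g₁ (proj₁ t) * h t) + q * (g₂ (proj₁ t) * h t)) ts
          ≡⟨ expect-+ _ _ ts ⟩
        expect (λ t → p * (g₁ (proj₁ t) * h t)) ts + expect (λ t → q * (g₂ (proj₁ t) * h t)) ts
          ≡⟨ cong₂ _+_ (expect-* _ p ts) (expect-* _ q ts) ⟩
        p * expect (λ t → g₁ (proj₁ t) * h t) ts + q * expect (λ t → g₂ (proj₁ t) * h t) ts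
          ≡⟨ cong₂ (λ x y → p * x + q * y) (expect-reweight h _ ts) (expect-reweight h _ ts) ⟨
        p * expect h ts₁ + q * expect h ts₂
          ≡⟨ cong₂ (λ x y → p * x + q * y) (proj₂ Δ₁'+ D) (proj₂ Δ₂'+ D) ⟨
        p * mass (proj₁ Δ₁'+) D + q * mass (proj₁ Δ₂'+) D
          ≡⟨ expect-mix _ (entries (proj₁ Δ₁'+)) (entries (proj₁ Δ₂'+)) ⟨
        mass (mixᵖ (proj₁ Δ₁'+) (proj₁ Δ₂'+)) D
          ∎
        where
        h : Conf n × Dist (Conf n) → Real
        h (_ , Ψ) = mass Ψ D

    -- The bisimulation formed by mixtures.

    -- Two relations are carried because the two hypotheses come with their own bisimulations; the
    -- union `∼cs` quantifies over relations and lives one universe too high to be used as a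
    -- component. Closing under `≈` is essential because a lifted transition fixes its target only
    -- up to masses.
    record Mix (𝓡₁ 𝓡₂ : TypedRel n) (Σ : Subset n) (Δ Θ : Dist (Conf n)) : Set where
      field
        Δ₁ Δ₂ Θ₁ Θ₂ : Dist (Conf n)
        related₁    : 𝓡₁ Σ Δ₁ Θ₁
        related₂    : 𝓡₂ Σ Δ₂ Θ₂
        Δ≈          : Δ ≈ mixᵖ Δ₁ Δ₂
        Θ≈          : Θ ≈ mixᵖ Θ₁ Θ₂
    open Mix

    Mix-converse : {𝓡₁ 𝓡₂ : TypedRel n} → ∀ {Σ Δ Θ} →
                   Mix 𝓡₁ 𝓡₂ Σ Δ Θ → Mix (converse 𝓡₁) (converse 𝓡₂) Σ Θ Δ
    Mix-converse m = record
      { related₁ = related₁ m ; related₂ = related₂ m ; Δ≈ = Θ≈ m ; Θ≈ = Δ≈ m }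

    -- The context distributes over the mixture, the move splits, each part is answered under the
    -- same context and index, and the answers are mixed again.
    Mix-simulation : {𝓡₁ 𝓡₂ : TypedRel n} →
                     Simulation 𝓡₁ → Simulation 𝓡₂ → Simulation (Mix 𝓡₁ 𝓡₂)
    Mix-simulation sim₁ sim₂ {Δ = Δ} {Θ} m {R = R} obs ⊢R disj {Δ' = Δ'} step =
      let Δ₁' , Δ₂' , move₁ , move₂ , Δ'≈ = ⇝ᴰ-unmix (R ⟦ Δ ⟧) (R ⟦ Δ₁ m ⟧) (R ⟦ Δ₂ m ⟧) Δ'
                                              (⟦⟧-mix R Δ (Δ₁ m) (Δ₂ m) (Δ≈ m)) step
          Θ₁' , answer₁ , related₁' = sim₁ (related₁ m) obs ⊢R disj {Δ' = Δ₁'} move₁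
          Θ₂' , answer₂ , related₂' = sim₂ (related₂ m) obs ⊢R disj {Δ' = Δ₂'} move₂
      in  mixᵖ Θ₁' Θ₂' ,
          ⇝ᴰ-mix (R ⟦ Θ ⟧) (R ⟦ Θ₁ m ⟧) (R ⟦ Θ₂ m ⟧) Θ₁' Θ₂'
            (⟦⟧-mix R Θ (Θ₁ m) (Θ₂ m) (Θ≈ m)) answer₁ answer₂ ,
          record { related₁ = related₁' ; related₂ = related₂' ; Δ≈ = Δ'≈ ; Θ≈ = λ _ → refl }

    -- A configuration with mass `0#` in both components has mass `0#` in the mixture, so the
    -- support of the mixture lies in the union of the two supports.
    mix-typed : ∀ {Σ : Subset n} (Δ Δ₁ Δ₂ : Dist (Conf n)) → Δ ≈ mixᵖ Δ₁ Δ₂ →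
                Σ ⊢ᴰ Δ₁ → Σ ⊢ᴰ Δ₂ → Σ ⊢ᴰ Δ
    mix-typed Δ Δ₁ Δ₂ Δ≈ ⊢Δ₁ ⊢Δ₂ C C∈Δ with em {mass Δ₁ C ≡ 0#} | em {mass Δ₂ C ≡ 0#}
    ... | no C∈Δ₁ | _         = ⊢Δ₁ C C∈Δ₁
    ... | yes _   | no C∈Δ₂   = ⊢Δ₂ C C∈Δ₂
    ... | yes Δ₁≡0 | yes Δ₂≡0 = contradiction Δ≡0 C∈Δ
      where
      Δ≡0 : mass Δ C ≡ 0#
      Δ≡0 = begin
        mass Δ C                        ≡⟨ Δ≈ C ⟩
        mass (mixᵖ Δ₁ Δ₂) C             ≡⟨ expect-mix _ (entries Δ₁) (entries Δ₂) ⟩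
        p * mass Δ₁ C + q * mass Δ₂ C   ≡⟨ cong₂ (λ x y → p * x + q * y) Δ₁≡0 Δ₂≡0 ⟩
        p * 0# + q * 0#                 ≡⟨ cong₂ _+_ (zeroʳ p) (zeroʳ q) ⟩
        0# + 0#                         ≡⟨ +-identityˡ 0# ⟩
        0#                              ∎

    Mix-Pr : {𝓡₁ 𝓡₂ : TypedRel n} → ∀ {Σ Δ Θ} (m : Mix 𝓡₁ 𝓡₂ Σ Δ Θ) (P : Conf n → Set) →
             Pr (Δ₁ m) P ≡ Pr (Θ₁ m) P → Pr (Δ₂ m) P ≡ Pr (Θ₂ m) P → Pr Δ P ≡ Pr Θ P
    Mix-Pr {Δ = Δ} {Θ} m P eq₁ eq₂ = begin
      Pr Δ P                              ≡⟨ Pr-cong Δ (mixᵖ (Δ₁ m) (Δ₂ m)) (Δ≈ m) P ⟩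
      Pr (mixᵖ (Δ₁ m) (Δ₂ m)) P           ≡⟨ expect-mix _ (entries (Δ₁ m)) (entries (Δ₂ m)) ⟩
      p * Pr (Δ₁ m) P + q * Pr (Δ₂ m) P   ≡⟨ cong₂ (λ x y → p * x + q * y) eq₁ eq₂ ⟩
      p * Pr (Θ₁ m) P + q * Pr (Θ₂ m) P   ≡⟨ expect-mix _ (entries (Θ₁ m)) (entries (Θ₂ m)) ⟨
      Pr (mixᵖ (Θ₁ m) (Θ₂ m)) P           ≡⟨ Pr-cong Θ (mixᵖ (Θ₁ m) (Θ₂ m)) (Θ≈ m) P ⟨
      Pr Θ P                              ∎

    Mix-isBisimulation : {𝓡₁ 𝓡₂ : TypedRel n} →
      IsBisimulation 𝓡₁ → IsBisimulation 𝓡₂ → IsBisimulation (Mix 𝓡₁ 𝓡₂)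
    Mix-isBisimulation {n} {𝓡₁} {𝓡₂} b₁ b₂ = record
      { typed = λ {_} {Δ} {Θ} m →
          let ⊢Δ₁ , ⊢Θ₁ = B₁.typed (related₁ m)
              ⊢Δ₂ , ⊢Θ₂ = B₂.typed (related₂ m)
          in  mix-typed Δ (Δ₁ m) (Δ₂ m) (Δ≈ m) ⊢Δ₁ ⊢Δ₂ , mix-typed Θ (Θ₁ m) (Θ₂ m) (Θ≈ m) ⊢Θ₁ ⊢Θ₂
      -- Instantiating the barb clause at the actual probability of the barb, with `refl`, turns the
      -- equivalence of barbs into an equality of probabilities for each component.
      ; barbs = λ m b x →
          let eq = Mix-Pr m (Ready b)
                     (sym (Equivalence.to (B₁.barbs (related₁ m) b _) refl))
                     (sym (Equivalence.to (B₂.barbs (related₂ m) b _) refl))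
          in  mk⇔ (trans (sym eq)) (trans eq)
      ; forth = Mix-simulation B₁.forth B₂.forth
      ; back  = λ m obs ⊢R disj step →
          let Δ' , answer , m' = Mix-simulation {𝓡₁ = converse 𝓡₁} {converse 𝓡₂} B₁.back B₂.back
                                   (Mix-converse m) obs ⊢R disj step
          in  Δ' , answer , Mix-converse m'
      }
      where
      module B₁ = IsBisimulation b₁
      module B₂ = IsBisimulation b₂

theorem4p4 : (em : ExcludedMiddle 0ℓ) (ℝ : Reals) →
    let open Reals ℝ
        open LqCCS em ℝ in
    (n : ℕ) (Σ : Subset n) (Δ₁ Δ₂ Θ₁ Θ₂ : Dist (Conf n)) →
    Σ ⊢ Δ₁ ∼cs Θ₁ →
    Σ ⊢ Δ₂ ∼cs Θ₂ →
    (p : Carrier) (0≤p : 0# ≤ p) (p≤1 : p ≤ 1#) →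
    Σ ⊢ mix p 0≤p p≤1 Δ₁ Δ₂ ∼cs mix p 0≤p p≤1 Θ₁ Θ₂
theorem4p4 em ℝ n Σ Δ₁ Δ₂ Θ₁ Θ₂ (𝓡₁ , b₁ , related₁) (𝓡₂ , b₂ , related₂) p 0≤p p≤1 =
  Mix em ℝ p 0≤p p≤1 𝓡₁ 𝓡₂ , Mix-isBisimulation em ℝ p 0≤p p≤1 b₁ b₂ ,
  record { related₁ = related₁ ; related₂ = related₂ ; Δ≈ = λ _ → refl ; Θ≈ = λ _ → refl }
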